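{- Let $S(n)=\sum_{i=1}^{n}(-1)^{e(i)}$ for $n\ge1$. Then $$\liminf_{n\to\infty}S(n)=-\infty\qquad\text{and}\qquad\limsup_{n\to\infty}S(n)=+\infty.$$
   Context: The Stern polynomials $B_n(t)\in\mathbb{Z}[t]$ are defined by $B_0(t)=0$, $B_1(t)=1$, and for $n\geq 1$: $B_{2n}(t)=tB_n(t)$, $B_{2n+1}(t)=B_n(t)+B_{n+1}(t)$. For $n\geq1$ let $e(n)=\deg B_n(t)$. -}

module Defs where

open import Data.Integer.Base as ℤ using (ℤ; 0ℤ; 1ℤ; -1ℤ)
import Data.Integer.Properties as ℤ
open import Data.List.Base using (List; []; _∷_)
open import Data.List.Relation.Unary.All using (All; []; _∷_; all?)
open import Data.Nat.Base using (ℕ; zero; suc; _+_; _*_; _≤_; _<_; s<s⁻¹; ⌊_/2⌋; ⌈_/2⌉; parity; NonZero)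
open import Data.Nat.Induction using (<-rec; <-wellFounded)
open import Data.Nat.Properties using (⌊n/2⌋<n; ⌈n/2⌉<n; +-suc; +-identityʳ; n≡⌊n+n/2⌋; n≡⌈n+n/2⌉)
open import Data.Parity.Base using (0ℙ; 1ℙ)
open import Data.Product.Base using (∃-syntax; _×_; _,_; proj₁; proj₂)
open import Induction.WellFounded using (WfRec; module FixPoint)
open import Relation.Binary.PropositionalEquality
open import Relation.Nullary using (¬_; yes; no; contradiction)

-- Elements of ℤ[t] as coefficient lists, constant term first.  Trailing zeros
-- are allowed, so a polynomial is zero when all its entries are.
Poly : Set
Poly = List ℤ

coeff : Poly → ℕ → ℤ
coeff []      _       = 0ℤ
coeff (a ∷ _) zero    = a
coeff (_ ∷ p) (suc k) = coeff p k

infixl 6 _⊕_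

_⊕_ : Poly → Poly → Poly
[]      ⊕ q       = q
p@(_ ∷ _) ⊕ []    = p
(a ∷ p) ⊕ (b ∷ q) = (a ℤ.+ b) ∷ (p ⊕ q)

t·_ : Poly → Poly
t· p = 0ℤ ∷ p

IsZero : Poly → Set
IsZero = All (_≡ 0ℤ)

-- The zero polynomial gets the junk value 0.
deg : Poly → ℕ
deg []      = 0
deg (_ ∷ p) with all? (ℤ._≟ 0ℤ) p
... | yes _ = 0
... | no  _ = suc (deg p)

coeff-zero : ∀ {p} → IsZero p → ∀ k → coeff p k ≡ 0ℤ
coeff-zero []       _       = refl
coeff-zero (a≡0 ∷ _) zero   = a≡0
coeff-zero (_ ∷ p≡0) (suc k) = coeff-zero p≡0 k

deg-correct : ∀ p → ¬ IsZero p →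
              coeff p (deg p) ≢ 0ℤ × (∀ k → deg p < k → coeff p k ≡ 0ℤ)
deg-correct []      p≢0 = contradiction [] p≢0
deg-correct (a ∷ p) p≢0 with all? (ℤ._≟ 0ℤ) p
... | yes p≡0 = (λ a≡0 → p≢0 (a≡0 ∷ p≡0)) , λ { (suc k) _ → coeff-zero p≡0 k }
... | no  q≢0 = proj₁ (deg-correct p q≢0)
              , λ { (suc k) d<k → proj₂ (deg-correct p q≢0) k (s<s⁻¹ d<k) }

-- The recurrence is written in terms of halves; stern-even and stern-odd
-- below give it in its usual form.
sternStep : ∀ n → WfRec _<_ (λ _ → Poly) n → Poly
sternStep 0 _ = []
sternStep 1 _ = 1ℤ ∷ []
sternStep n@(suc (suc m)) B with parity n
... | 0ℙ = t· B {⌊ n /2⌋} (⌊n/2⌋<n (suc m))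
... | 1ℙ = B {⌊ n /2⌋} (⌊n/2⌋<n (suc m)) ⊕ B {⌈ n /2⌉} (⌈n/2⌉<n m)

stern : ℕ → Poly
stern = <-rec (λ _ → Poly) sternStep

private
  sternStep-ext : ∀ n {B B′ : WfRec _<_ (λ _ → Poly) n} →
                  (∀ {m} m<n → B {m} m<n ≡ B′ m<n) → sternStep n B ≡ sternStep n B′
  sternStep-ext 0 _ = refl
  sternStep-ext 1 _ = refl
  sternStep-ext n@(suc (suc m)) eq with parity n
  ... | 0ℙ = cong t·_ (eq _)
  ... | 1ℙ = cong₂ _⊕_ (eq _) (eq _)

  stern-unfold : ∀ n → stern n ≡ sternStep n (λ {m} _ → stern m)
  stern-unfold n = FixPoint.unfold-wfRec <-wellFounded (λ _ → Poly) sternStep sternStep-ext {n}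

  parity-n+n : ∀ n → parity (n + n) ≡ 0ℙ
  parity-n+n zero = refl
  parity-n+n (suc n) rewrite +-suc n n = parity-n+n n

  parity-1+n+n : ∀ n → parity (suc (n + n)) ≡ 1ℙ
  parity-1+n+n zero = refl
  parity-1+n+n (suc n) rewrite +-suc n n = parity-1+n+n n

  ⌊1+n+n/2⌋≡n : ∀ n → ⌊ suc (n + n) /2⌋ ≡ n
  ⌊1+n+n/2⌋≡n n = sym (n≡⌈n+n/2⌉ n)

stern-0 : stern 0 ≡ []
stern-0 = refl

stern-1 : stern 1 ≡ 1ℤ ∷ []
stern-1 = refl

stern-even : ∀ n .{{_ : NonZero n}} → stern (2 * n) ≡ t· stern n
stern-even (suc k)
  rewrite +-identityʳ k | +-suc k k
        | stern-unfold (suc (suc (k + k))) | parity-n+n k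
        | sym (n≡⌊n+n/2⌋ k) = refl

stern-odd : ∀ n .{{_ : NonZero n}} → stern (2 * n + 1) ≡ stern n ⊕ stern (n + 1)
stern-odd (suc k)
  rewrite +-identityʳ k | +-suc k k | +-suc (k + k) 0 | +-identityʳ (k + k)
        | +-suc k 0 | +-identityʳ k
        | stern-unfold (suc (suc (suc (k + k)))) | parity-1+n+n k
        | ⌊1+n+n/2⌋≡n k | sym (n≡⌊n+n/2⌋ k) = refl

e : ℕ → ℕ
e n = deg (stern n)

S : ℕ → ℤ
S zero    = 0ℤ
S (suc n) = S n ℤ.+ -1ℤ ℤ.^ e (suc n)

-- inf { s n ∣ n ≥ N } = -∞ and sup { s n ∣ n ≥ N } = +∞.
TailInf≡-∞ TailSup≡+∞ : (ℕ → ℤ) → ℕ → Set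
TailInf≡-∞ s N = ∀ (M : ℤ) → ∃[ n ] (N ≤ n × s n ℤ.< M)
TailSup≡+∞ s N = ∀ (M : ℤ) → ∃[ n ] (N ≤ n × M ℤ.< s n)

-- lim inf s = sup_N inf_{n ≥ N} s n, which is -∞ exactly when every tail
-- infimum is -∞; dually for lim sup.
Liminf≡-∞ Limsup≡+∞ : (ℕ → ℤ) → Set
Liminf≡-∞ s = ∀ N → TailInf≡-∞ s N
Limsup≡+∞ s = ∀ N → TailSup≡+∞ s N

{-# OPTIONS --safe #-}

-- As Stern polynomials have nonnegative coefficients, e (2n) = e n + 1 and
-- e (2n + 1) = max (e n) (e (n + 1)); hence e (n + 1) - e n ∈ {1, 0, -1} for n ≥ 1, and
-- the sum of (-1)^e(i) over 2^k n ≤ i < 2^k (n + 1) is (-1)^e(n) times a number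
-- depending only on k and on this difference.  It follows that A k = S (2^k - 1)
-- satisfies A (k + 2) = - A (k + 1) - 2 A k + ε k, where ε alternates between 0 and 2.
-- Up to an error of at most 2, A (k + 3) is 2 A k - A (k + 1) and A (k + 4) is
-- 2 A k + 3 A (k + 1), so one of the two is at least 2 A k - 2 when A k ≥ 0, and at most
-- 2 A k + 2 when A k ≤ 0.  Starting from A 7 = 5 and A 8 = -3, A is unbounded both ways.
module Submission where

open import Defs
open import Data.Integer.Base as ℤ using (ℤ; 0ℤ; 1ℤ; -1ℤ; +_; ∣_∣)
import Data.Integer.Properties as ℤ
open import Data.Integer.Tactic.RingSolver using (solve-∀)
open import Data.List.Base using ([]; _∷_)
open import Data.List.Relation.Unary.All using (All; []; _∷_; all?)
open import Data.Nat.Base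
open import Data.Nat.Induction using (<-rec)
open import Data.Nat.Properties
open import Data.Product.Base using (_×_; _,_; proj₁; ∃-syntax)
open import Data.Sum.Base using (_⊎_; inj₁; inj₂)
open import Relation.Binary.PropositionalEquality
open import Relation.Nullary using (¬_; yes; no; contradiction)

-- Degrees of polynomials with nonnegative coefficients

NonNeg : Poly → Set
NonNeg = All (0ℤ ℤ.≤_)

⊕-nonNeg : ∀ {p q} → NonNeg p → NonNeg q → NonNeg (p ⊕ q)
⊕-nonNeg []       qs       = qs
⊕-nonNeg (a ∷ ps) []       = a ∷ ps
⊕-nonNeg (a ∷ ps) (b ∷ qs) = ℤ.+-mono-≤ a b ∷ ⊕-nonNeg ps qs

⊕-isZero : ∀ {p q} → IsZero p → IsZero q → IsZero (p ⊕ q)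
⊕-isZero []         qs         = qs
⊕-isZero (a ∷ ps)   []         = a ∷ ps
⊕-isZero (refl ∷ ps) (refl ∷ qs) = refl ∷ ⊕-isZero ps qs

a+b≡0⇒a≡0 : ∀ {a b} → 0ℤ ℤ.≤ a → 0ℤ ℤ.≤ b → a ℤ.+ b ≡ 0ℤ → a ≡ 0ℤ
a+b≡0⇒a≡0 {+ zero}  _ _ _ = refl
a+b≡0⇒a≡0 {+ suc _} {+ _} _ _ ()

⊕-isZero⁻ˡ : ∀ {p q} → NonNeg p → NonNeg q → IsZero (p ⊕ q) → IsZero p
⊕-isZero⁻ˡ []       _        _        = []
⊕-isZero⁻ˡ (_ ∷ _)  []       zs       = zs
⊕-isZero⁻ˡ (a ∷ ps) (b ∷ qs) (z ∷ zs) = a+b≡0⇒a≡0 a b z ∷ ⊕-isZero⁻ˡ ps qs zs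

⊕-isZero⁻ʳ : ∀ {p q} → NonNeg p → NonNeg q → IsZero (p ⊕ q) → IsZero q
⊕-isZero⁻ʳ []       _        zs       = zs
⊕-isZero⁻ʳ (_ ∷ _)  []       _        = []
⊕-isZero⁻ʳ {a ∷ _} {b ∷ _} (0≤a ∷ ps) (0≤b ∷ qs) (z ∷ zs) =
  a+b≡0⇒a≡0 0≤b 0≤a (trans (ℤ.+-comm b a) z) ∷ ⊕-isZero⁻ʳ ps qs zs

deg-isZero : ∀ {p} → IsZero p → deg p ≡ 0
deg-isZero []                 = refl
deg-isZero {_ ∷ p} (_ ∷ zs) with all? (ℤ._≟ 0ℤ) p
... | yes _  = refl
... | no ¬zs = contradiction zs ¬zs

-- Nonnegative coefficients cannot cancel, so the tail of the sum vanishes only if both tails do. A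
-- vanishing tail has degree 0 and drops out of the maximum.
deg-⊕ : ∀ {p q} → NonNeg p → NonNeg q → deg (p ⊕ q) ≡ deg p ⊔ deg q
deg-⊕ []       _  = refl
deg-⊕ (_ ∷ _)  [] = sym (⊔-identityʳ _)
deg-⊕ {_ ∷ p} {_ ∷ q} (_ ∷ ps) (_ ∷ qs)
  with all? (ℤ._≟ 0ℤ) p | all? (ℤ._≟ 0ℤ) q | all? (ℤ._≟ 0ℤ) (p ⊕ q) | deg-⊕ ps qs
... | yes _  | yes _  | yes _  | _  = refl
... | yes zp | yes zq | no ¬z  | _  = contradiction (⊕-isZero zp zq) ¬z
... | no ¬zp | _      | yes z  | _  = contradiction (⊕-isZero⁻ˡ ps qs z) ¬zp
... | yes _  | no ¬zq | yes z  | _  = contradiction (⊕-isZero⁻ʳ ps qs z) ¬zq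
... | yes zp | no _   | no _   | ih = cong suc (trans ih (cong (_⊔ deg q) (deg-isZero zp)))
... | no _   | yes zq | no _   | ih =
  cong suc (trans ih (trans (cong (deg p ⊔_) (deg-isZero zq)) (⊔-identityʳ _)))
... | no _   | no _   | no _   | ih = cong suc ih

-- The zero polynomial is excluded: both it and its product with `t` get the junk degree 0.
deg-t· : ∀ {p} → ¬ IsZero p → deg (t· p) ≡ suc (deg p)
deg-t· {p} ¬z with all? (ℤ._≟ 0ℤ) p
... | yes z = contradiction z ¬z
... | no _  = refl

-- Degrees of Stern polynomials

data Halving : ℕ → Set where
  even : ∀ m → Halving (2 * m)
  odd  : ∀ m → Halving (2 * m + 1)

halving : ∀ n → Halving n
halving zero = even 0
halving (suc n) with halving n
... | even m = subst Halving (+-comm (2 * m) 1) (odd m)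
... | odd m  = subst Halving (trans (*-suc 2 m) (cong suc (+-comm 1 (2 * m)))) (even (suc m))

Positive : Poly → Set
Positive p = NonNeg p × ¬ IsZero p

-- Both halves go through one induction, since a sum is seen to be nonzero only when its summands
-- are known to be nonnegative.
stern-positive : ∀ n → .{{NonZero n}} → Positive (stern n)
stern-positive n = <-rec (λ n → .{{NonZero n}} → Positive (stern n)) step n
  where
  step : ∀ n → (∀ {m} → m < n → .{{NonZero m}} → Positive (stern m)) →
         .{{NonZero n}} → Positive (stern n)
  step n rec with halving n
  ... | odd zero = (ℤ.+≤+ z≤n ∷ []) , λ { (() ∷ _) }
  ... | even (suc m) =
    let nn , nz = rec (m<m+n (suc m) (s≤s z≤n)) in
    subst Positive (sym (stern-even (suc m)))
      ((ℤ.≤-refl ∷ nn) , λ { (_ ∷ z) → nz z })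
  ... | odd (suc m) =
    let nn , nz = rec {suc m} (≤-trans (m<m+n (suc m) (s≤s z≤n)) (m≤m+n _ 1))
        nn′ , _ = rec {suc m + 1} (+-monoˡ-< 1 (m<m+n (suc m) (s≤s z≤n)))
    in subst Positive (sym (stern-odd (suc m)))
      (⊕-nonNeg nn nn′ , λ z → nz (⊕-isZero⁻ˡ nn nn′ z))

e-even : ∀ n .{{_ : NonZero n}} → e (2 * n) ≡ suc (e n)
e-even n = let _ , nz = stern-positive n in
  trans (cong deg (stern-even n)) (deg-t· nz)

e-odd : ∀ n .{{_ : NonZero n}} → e (suc (2 * n)) ≡ e n ⊔ e (suc n)
e-odd n = let nn , _ = stern-positive n ; nn′ , _ = stern-positive (suc n) in
  trans (cong e (+-comm 1 (2 * n)))
    (trans (cong deg (trans (stern-odd n) (cong (λ m → stern n ⊕ stern m) (+-comm n 1))))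
      (deg-⊕ nn nn′))

-- Sums over dyadic blocks

sgn : ℕ → ℤ
sgn x = -1ℤ ℤ.^ x

data Slope : Set where
  up level down : Slope

Step : Slope → ℕ → ℕ → Set
Step up    x y = y ≡ suc x
Step level x y = y ≡ x
Step down  x y = x ≡ suc y

-- The sum of `(-1)^(e i - e n)` over `2^k n ≤ i < 2^k (n + 1)`, when `e` has the given slope from
-- `n` to `n + 1`. The two terms come from the blocks at `2n` and `2n + 1`: `e (2n)` always exceeds
-- `e n` by one, while `e (2n + 1)` does so only for slope `up`.
blockSum : ℕ → Slope → ℤ
blockSum zero    _     = 1ℤ
blockSum (suc k) up    = ℤ.- blockSum k level ℤ.- blockSum k up
blockSum (suc k) level = ℤ.- blockSum k down ℤ.+ blockSum k up
blockSum (suc k) down  = ℤ.- blockSum k down ℤ.+ blockSum k level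

-- The slopes of `e` from `2n` to `2n + 1` and from `2n + 1` to `2n + 2`, given the one from `n` to
-- `n + 1`.
left right : Slope → Slope
left up    = level
left level = down
left down  = down
right up    = up
right level = up
right down  = level

left-step : ∀ d {x y} → Step d x y → Step (left d) (suc x) (x ⊔ y)
left-step up    {x} refl = m≤n⇒m⊔n≡n (n≤1+n x)
left-step level {x} refl = cong suc (sym (⊔-idem x))
left-step down  {_} {y} refl = cong suc (sym (m≥n⇒m⊔n≡m (n≤1+n y)))

right-step : ∀ d {x y} → Step d x y → Step (right d) (x ⊔ y) (suc y)
right-step up    {x} refl = cong suc (sym (m≤n⇒m⊔n≡n (n≤1+n x)))
right-step level {x} refl = cong suc (sym (⊔-idem x))
right-step down  {_} {y} refl = sym (m≥n⇒m⊔n≡m (n≤1+n y))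

blockSum-split : ∀ k d {x y} → Step d x y →
  sgn (suc x) ℤ.* blockSum k (left d) ℤ.+ sgn (x ⊔ y) ℤ.* blockSum k (right d)
    ≡ sgn x ℤ.* blockSum (suc k) d
blockSum-split k up {x} refl rewrite m≤n⇒m⊔n≡n (n≤1+n x) =
  eq (sgn x) (blockSum k level) (blockSum k up)
  where
  eq : ∀ s a b → -1ℤ ℤ.* s ℤ.* a ℤ.+ -1ℤ ℤ.* s ℤ.* b ≡ s ℤ.* (ℤ.- a ℤ.- b)
  eq = solve-∀
blockSum-split k level {x} refl rewrite ⊔-idem x =
  eq (sgn x) (blockSum k down) (blockSum k up)
  where
  eq : ∀ s a b → -1ℤ ℤ.* s ℤ.* a ℤ.+ s ℤ.* b ≡ s ℤ.* (ℤ.- a ℤ.+ b)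
  eq = solve-∀
blockSum-split k down {_} {y} refl rewrite m≥n⇒m⊔n≡m (n≤1+n y) =
  eq (sgn (suc y)) (blockSum k down) (blockSum k level)
  where
  eq : ∀ s a b → -1ℤ ℤ.* s ℤ.* a ℤ.+ s ℤ.* b ≡ s ℤ.* (ℤ.- a ℤ.+ b)
  eq = solve-∀

-- Summing over `1 ≤ i < n` makes half-open dyadic blocks differences of values of `T`.
T : ℕ → ℤ
T n = S (pred n)

2^[1+k]* : ∀ k m → 2 ^ suc k * m ≡ 2 ^ k * (2 * m)
2^[1+k]* k m = trans (cong (_* m) (*-comm 2 (2 ^ k))) (*-assoc (2 ^ k) 2 m)

-- Induction on `k` with `n` and `d` general: the block at `n` is the block at `2n` followed by the
-- one at `2n + 1`, each of half the length.
T-block : ∀ k n .{{_ : NonZero n}} d → Step d (e n) (e (suc n)) →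
          T (2 ^ k * suc n) ≡ T (2 ^ k * n) ℤ.+ sgn (e n) ℤ.* blockSum k d
T-block zero (suc n) d _ rewrite +-identityʳ n =
  cong (λ z → S n ℤ.+ z) (sym (ℤ.*-identityʳ (sgn (e (suc n)))))
T-block (suc k) n@(suc _) d st = begin
  T (2 ^ suc k * suc n)                    ≡⟨ cong T (2^[1+k]* k (suc n)) ⟩
  T (2 ^ k * (2 * suc n))                  ≡⟨ cong (λ m → T (2 ^ k * m)) (*-suc 2 n) ⟩
  T (2 ^ k * suc (suc (2 * n)))            ≡⟨ T-block k (suc (2 * n)) (right d) stʳ ⟩
  T (2 ^ k * suc (2 * n)) ℤ.+ R            ≡⟨ cong (ℤ._+ R) (T-block k (2 * n) (left d) stˡ) ⟩
  T (2 ^ k * (2 * n)) ℤ.+ L ℤ.+ R          ≡⟨ ℤ.+-assoc (T (2 ^ k * (2 * n))) L R ⟩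
  T (2 ^ k * (2 * n)) ℤ.+ (L ℤ.+ R)        ≡⟨ cong₂ ℤ._+_ (cong T (sym (2^[1+k]* k n))) LR ⟩
  T (2 ^ suc k * n) ℤ.+ sgn (e n) ℤ.* blockSum (suc k) d ∎
  where
  open ≡-Reasoning
  L R : ℤ
  L = sgn (e (2 * n)) ℤ.* blockSum k (left d)
  R = sgn (e (suc (2 * n))) ℤ.* blockSum k (right d)
  stˡ : Step (left d) (e (2 * n)) (e (suc (2 * n)))
  stˡ = subst₂ (Step (left d)) (sym (e-even n)) (sym (e-odd n)) (left-step d st)
  stʳ : Step (right d) (e (suc (2 * n))) (e (suc (suc (2 * n))))
  stʳ = subst₂ (Step (right d)) (sym (e-odd n))
          (sym (trans (cong e (sym (*-suc 2 n))) (e-even (suc n)))) (right-step d st)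
  LR : L ℤ.+ R ≡ sgn (e n) ℤ.* blockSum (suc k) d
  LR = trans (cong₂ (λ x y → sgn x ℤ.* blockSum k (left d) ℤ.+ sgn y ℤ.* blockSum k (right d))
                    (e-even n) (e-odd n))
             (blockSum-split k d st)

A : ℕ → ℤ
A zero    = 0ℤ
A (suc k) = A k ℤ.+ blockSum k up

T-2^ : ∀ k → T (2 ^ k) ≡ A k
T-2^ zero    = refl
T-2^ (suc k) = begin
  T (2 ^ suc k)                          ≡⟨ cong T (*-comm 2 (2 ^ k)) ⟩
  -- The block at 1 has slope `up`, as `e 1 = 0` and `e 2 = 1`.
  T (2 ^ k * 2)                          ≡⟨ T-block k 1 up refl ⟩
  T (2 ^ k * 1) ℤ.+ 1ℤ ℤ.* blockSum k up ≡⟨ cong₂ ℤ._+_ (cong T (*-identityʳ (2 ^ k))) (ℤ.*-identityˡ (blockSum k up)) ⟩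
  T (2 ^ k) ℤ.+ blockSum k up            ≡⟨ cong (ℤ._+ blockSum k up) (T-2^ k) ⟩
  A k ℤ.+ blockSum k up                  ∎
  where open ≡-Reasoning

-- The linear recurrence for A

-- ε k = A (2 + k) + A (1 + k) + 2 A k, written out in terms of block sums.
ε : ℕ → ℤ
ε k = + 4 ℤ.* A k ℤ.+ blockSum k up ℤ.- blockSum k level

ε-periodic : ∀ k → ε (suc (suc k)) ≡ ε k
ε-periodic k = eq (A k) (blockSum k up) (blockSum k level) (blockSum k down)
  where
  eq : ∀ x a b c →
    + 4 ℤ.* (x ℤ.+ a ℤ.+ (ℤ.- b ℤ.- a)) ℤ.+ (ℤ.- (ℤ.- c ℤ.+ a) ℤ.- (ℤ.- b ℤ.- a))
      ℤ.- (ℤ.- (ℤ.- c ℤ.+ b) ℤ.+ (ℤ.- b ℤ.- a))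
      ≡ + 4 ℤ.* x ℤ.+ a ℤ.- b
  eq = solve-∀

ε-values : ∀ k → (ε k ≡ 0ℤ × ε (suc k) ≡ + 2) ⊎ (ε k ≡ + 2 × ε (suc k) ≡ 0ℤ)
ε-values zero = inj₁ (refl , refl)
ε-values (suc k) with ε-values k
... | inj₁ (p , q) = inj₂ (q , trans (ε-periodic k) p)
... | inj₂ (p , q) = inj₁ (q , trans (ε-periodic k) p)

-- Here and in `A-4+` the recurrence is used to eliminate `A (2 + k)`; in `A-4+` the terms in `ε k`
-- cancel by periodicity.
A-3+ : ∀ k → A (3 + k) ≡ + 2 ℤ.* A k ℤ.- A (suc k) ℤ.+ (ε (suc k) ℤ.- ε k)
A-3+ k = eq (A k) (blockSum k up) (blockSum k level) (blockSum k down)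
  where
  eq : ∀ x a b c →
    x ℤ.+ a ℤ.+ (ℤ.- b ℤ.- a) ℤ.+ (ℤ.- (ℤ.- c ℤ.+ a) ℤ.- (ℤ.- b ℤ.- a))
      ≡ + 2 ℤ.* x ℤ.- (x ℤ.+ a)
        ℤ.+ (+ 4 ℤ.* (x ℤ.+ a) ℤ.+ (ℤ.- b ℤ.- a) ℤ.- (ℤ.- c ℤ.+ a) ℤ.- (+ 4 ℤ.* x ℤ.+ a ℤ.- b))
  eq = solve-∀

A-4+ : ∀ k → A (4 + k) ≡ + 2 ℤ.* A k ℤ.+ + 3 ℤ.* A (suc k) ℤ.- ε (suc k)
A-4+ k = eq (A k) (blockSum k up) (blockSum k level) (blockSum k down)
  where
  eq : ∀ x a b c →
    x ℤ.+ a ℤ.+ (ℤ.- b ℤ.- a) ℤ.+ (ℤ.- (ℤ.- c ℤ.+ a) ℤ.- (ℤ.- b ℤ.- a))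
      ℤ.+ (ℤ.- (ℤ.- (ℤ.- c ℤ.+ b) ℤ.+ (ℤ.- b ℤ.- a)) ℤ.- (ℤ.- (ℤ.- c ℤ.+ a) ℤ.- (ℤ.- b ℤ.- a)))
      ≡ + 2 ℤ.* x ℤ.+ + 3 ℤ.* (x ℤ.+ a)
        ℤ.- (+ 4 ℤ.* (x ℤ.+ a) ℤ.+ (ℤ.- b ℤ.- a) ℤ.- (ℤ.- c ℤ.+ a))
  eq = solve-∀

-- Growth under the perturbed recurrences

-2≤_≤2 : ℤ → Set
-2≤ z ≤2 = ℤ.- + 2 ℤ.≤ z × z ℤ.≤ + 2

neg-bounded : ∀ {z} → -2≤ z ≤2 → -2≤ ℤ.- z ≤2
neg-bounded (l , u) = ℤ.neg-mono-≤ u , ℤ.neg-mono-≤ l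

-- These properties survive negation, so one growth argument yields unboundedness in both
-- directions.
record Expanding (u : ℕ → ℤ) : Set where
  field
    η ζ : ℕ → ℤ
    η-bounded : ∀ k → -2≤ η k ≤2
    ζ-bounded : ∀ k → -2≤ ζ k ≤2
    u-3+ : ∀ k → u (3 + k) ≡ + 2 ℤ.* u k ℤ.- u (suc k) ℤ.+ η k
    u-4+ : ∀ k → u (4 + k) ≡ + 2 ℤ.* u k ℤ.+ + 3 ℤ.* u (suc k) ℤ.+ ζ k

A-expanding : Expanding A
A-expanding = record
  { η = λ k → ε (suc k) ℤ.- ε k
  ; ζ = λ k → ℤ.- ε (suc k)
  ; η-bounded = η-bounded
  ; ζ-bounded = ζ-bounded
  ; u-3+ = A-3+
  ; u-4+ = A-4+
  }
  where
  η-bounded : ∀ k → -2≤ ε (suc k) ℤ.- ε k ≤2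
  η-bounded k with ε k | ε (suc k) | ε-values k
  ... | _ | _ | inj₁ (refl , refl) = ℤ.-≤+ , ℤ.≤-refl
  ... | _ | _ | inj₂ (refl , refl) = ℤ.≤-refl , ℤ.-≤+
  ζ-bounded : ∀ k → -2≤ ℤ.- ε (suc k) ≤2
  ζ-bounded k with ε (suc k) | ε-values k
  ... | _ | inj₁ (_ , refl) = ℤ.≤-refl , ℤ.-≤+
  ... | _ | inj₂ (_ , refl) = ℤ.-≤+ , ℤ.+≤+ z≤n

negate-expanding : ∀ {u} → Expanding u → Expanding (λ k → ℤ.- u k)
negate-expanding {u} E = record
  { η = λ k → ℤ.- η k
  ; ζ = λ k → ℤ.- ζ k
  ; η-bounded = λ k → neg-bounded (η-bounded k)
  ; ζ-bounded = λ k → neg-bounded (ζ-bounded k)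
  ; u-3+ = λ k → trans (cong ℤ.-_ (u-3+ k)) (eq₃ (u k) (u (suc k)) (η k))
  ; u-4+ = λ k → trans (cong ℤ.-_ (u-4+ k)) (eq₄ (u k) (u (suc k)) (ζ k))
  }
  where
  open Expanding E
  eq₃ : ∀ x y z → ℤ.- (+ 2 ℤ.* x ℤ.- y ℤ.+ z) ≡ + 2 ℤ.* ℤ.- x ℤ.- ℤ.- y ℤ.+ ℤ.- z
  eq₃ = solve-∀
  eq₄ : ∀ x y z → ℤ.- (+ 2 ℤ.* x ℤ.+ + 3 ℤ.* y ℤ.+ z) ≡ + 2 ℤ.* ℤ.- x ℤ.+ + 3 ℤ.* ℤ.- y ℤ.+ ℤ.- z
  eq₄ = solve-∀

-- The offset 3 is the least start at which doubling and then losing 2 is a strict gain. The term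
-- `w` stands for the multiple of `u (suc k)` that has the favourable sign.
2m-2≥1+m : ∀ {x z w} m → + (3 + m) ℤ.≤ x → ℤ.- + 2 ℤ.≤ z → 0ℤ ℤ.≤ w →
           + (4 + m) ℤ.≤ + 2 ℤ.* x ℤ.+ w ℤ.+ z
2m-2≥1+m {x} {z} {w} m m≤x -2≤z 0≤w = begin
  + (4 + m)                                 ≤⟨ ℤ.+≤+ (+-monoʳ-≤ 4 (m≤m+n m m)) ⟩
  + (4 + (m + m))                           ≡⟨ eq (+ m) ⟩
  + 2 ℤ.* + (3 + m) ℤ.+ 0ℤ ℤ.- + 2          ≤⟨ ℤ.+-mono-≤ (ℤ.+-mono-≤ (ℤ.*-monoˡ-≤-nonNeg (+ 2) m≤x) 0≤w) -2≤z ⟩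
  + 2 ℤ.* x ℤ.+ w ℤ.+ z                     ∎
  where
  open ℤ.≤-Reasoning
  eq : ∀ n → + 4 ℤ.+ (n ℤ.+ n) ≡ + 2 ℤ.* (+ 3 ℤ.+ n) ℤ.+ 0ℤ ℤ.- + 2
  eq = solve-∀

-- If u k is large then u (3 + k) or u (4 + k), according to the sign of u (1 + k),
-- is almost twice as large.
expanding⇒unbounded : ∀ {u} → Expanding u → (∃[ k ] + 3 ℤ.≤ u k) →
                      ∀ j → ∃[ k ] (j ≤ k × + (3 + j) ℤ.≤ u k)
expanding⇒unbounded E (k , 3≤u) zero = k , z≤n , 3≤u
expanding⇒unbounded {u} E start (suc j) with expanding⇒unbounded E start j
... | k , j≤k , large with ℤ.≤-total 0ℤ (u (suc k))
...   | inj₁ 0≤y = 4 + k , s≤s (m≤n⇒m≤o+n 3 j≤k)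
                 , subst (+ (4 + j) ℤ.≤_) (sym (u-4+ k))
                     (2m-2≥1+m j large (proj₁ (ζ-bounded k)) (ℤ.*-monoˡ-≤-nonNeg (+ 3) 0≤y))
  where open Expanding E
...   | inj₂ y≤0 = 3 + k , s≤s (m≤n⇒m≤o+n 2 j≤k)
                 , subst (+ (4 + j) ℤ.≤_) (sym (u-3+ k))
                     (2m-2≥1+m j large (proj₁ (η-bounded k)) (ℤ.neg-mono-≤ y≤0))
  where open Expanding E

A-unbounded : ∀ j → ∃[ k ] (j ≤ k × + (3 + j) ℤ.≤ A k)
-- `A 7 = 5` is the first value to reach 3; all earlier ones lie between -1 and 1.
A-unbounded = expanding⇒unbounded A-expanding (7 , ℤ.+≤+ (s≤s (s≤s (s≤s z≤n))))

-A-unbounded : ∀ j → ∃[ k ] (j ≤ k × + (3 + j) ℤ.≤ ℤ.- A k)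
-- `A 8 = -3` meets the threshold exactly.
-A-unbounded = expanding⇒unbounded (negate-expanding A-expanding) (8 , ℤ.≤-refl)

-- From powers of two to the tails of `S`

i≤+∣i∣ : ∀ i → i ℤ.≤ + ∣ i ∣
i≤+∣i∣ (+ n)      = ℤ.≤-refl
i≤+∣i∣ ℤ.-[1+ n ] = ℤ.-≤+

i<3+n+∣i∣ : ∀ n i → i ℤ.< + (3 + (n + ∣ i ∣))
i<3+n+∣i∣ n i = ℤ.≤-<-trans (i≤+∣i∣ i) (ℤ.+<+ (s≤s (m≤n⇒m≤o+n 2 (m≤n+m ∣ i ∣ n))))

n<2^n : ∀ n → n < 2 ^ n
n<2^n zero    = s≤s z≤n
n<2^n (suc n) = ≤-trans (+-mono-≤ (m^n>0 2 n) (n<2^n n)) (+-monoʳ-≤ (2 ^ n) (m≤m+n (2 ^ n) 0))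

n≤pred2^n : ∀ n → n ≤ pred (2 ^ n)
n≤pred2^n n = pred-mono-≤ (n<2^n n)

mainTheorem16 : Liminf≡-∞ S × Limsup≡+∞ S
mainTheorem16 = liminf , limsup
  where
  -- Asking for `N + ∣ M ∣` lets one `k` serve twice: it pushes the index `pred (2 ^ k)` past `N`
  -- and the value past `M`. For the lower limit this is applied to `- M` and `- A`.
  tail : ∀ N M k → N + ∣ M ∣ ≤ k → N ≤ pred (2 ^ k)
  tail N M k le = ≤-trans (≤-trans (m≤m+n N ∣ M ∣) le) (n≤pred2^n k)

  liminf : Liminf≡-∞ S
  liminf N M = let k , le , large = -A-unbounded (N + ∣ ℤ.- M ∣) in
    pred (2 ^ k) , tail N (ℤ.- M) k le ,
    ℤ.neg-cancel-< (subst (λ z → ℤ.- M ℤ.< ℤ.- z) (sym (T-2^ k))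
                     (ℤ.<-≤-trans (i<3+n+∣i∣ N (ℤ.- M)) large))

  limsup : Limsup≡+∞ S
  limsup N M = let k , le , large = A-unbounded (N + ∣ M ∣) in
    pred (2 ^ k) , tail N M k le ,
    subst (M ℤ.<_) (sym (T-2^ k)) (ℤ.<-≤-trans (i<3+n+∣i∣ N M) large)
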